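{- Let $\sigma$ be an $r$-signotope on $[n]$ with corresponding partial order $\prec$, and let $\prec_{\mathrm{rot}}$ be the partial order corresponding to $\sigma_{\mathrm{rot}}$. Let $I,J$ be $(r-1)$-subsets of $[n]$ with $|I\cap J|=r-2$ and $I\prec J$. Then $I_{\mathrm{rot}}\prec_{\mathrm{rot}}J_{\mathrm{rot}}$ if $1\notin I\cap J$, and $I_{\mathrm{rot}}\succ_{\mathrm{rot}}J_{\mathrm{rot}}$ if $1\in I\cap J$.
   Context: An $r$-signotope on $[n]$ is a map $\sigma:\binom{[n]}{r}\to\{+,-\}$ such that for every $(r+1)$-subset $X=\{x_1<\dots<x_{r+1}\}$ the sequence $\sigma(X_1),\dots,\sigma(X_{r+1})$ has at most one sign change, where $X_j=X\setminus\{x_j\}$. The partial order corresponding to $\sigma$ is the transitive closure of the relations on $(r-1)$-subsets: for every $r$-subset $X=\{x_1<\dots<x_r\}$, $X_1\succ\dots\succ X_r$ if $\sigma(X)=+$ and $X_1\prec\dots\prec X_r$ if $\sigma(X)=-$. The clockwise rotation is $\sigma_{\mathrm{rot}}(x_1,\dots,x_r)=-\sigma(1,x_1+1,\dots,x_{r-1}+1)$ if $x_r=n$ and $\sigma_{\mathrm{rot}}(x_1,\dots,x_r)=\sigma(x_1+1,\dots,x_r+1)$ if $x_r<n$ (for $x_1<\dots<x_r$). For $x\in[n]$, $x_{\mathrm{rot}}=x-1$ if $x\ne1$, $1_{\mathrm{rot}}=n$, and $X_{\mathrm{rot}}=\{x_{\mathrm{rot}}:x\in X\}$. -}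

module Defs where

open import Data.Nat using (ℕ; zero; suc; _+_; _≤_)
open import Data.Fin using (Fin; zero; suc; fromℕ; inject₁; _≟_)
open import Data.Fin.Subset using (Subset; _∈_; _-_; ∣_∣)
open import Data.Fin.Subset.Properties using (_∈?_)
open import Data.Fin.Base using ()
open import Data.List using (List; []; _∷_; filter; map; _++_; allFin)
open import Data.Bool.ListAction using (any)
open import Data.List.Base using ()
open import Data.Vec using (tabulate; lookup)
open import Data.Sign using (Sign; opposite)
import Data.Sign as S
open import Data.Bool using (Bool; true; false; if_then_else_)
open import Data.Product using (Σ; ∃; _×_; _,_)
open import Relation.Binary.PropositionalEquality using (_≡_)
open import Relation.Binary.Construct.Closure.Transitive using (TransClosure)
open import Relation.Nullary using (does)

-- Ground set [n] is Fin n; the element 1 is 'zero', the element n is the last element.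
-- A sign assignment on subsets; only its values on r-subsets are relevant.
SignMap : ℕ → Set
SignMap n = Subset n → Sign

-- Elements of X in increasing order (x₁ < … < x_k).
elems : ∀ {n} → Subset n → List (Fin n)
elems {n} X = filter (λ i → i ∈? X) (allFin n)

-- Number of sign changes in a sequence of signs.
signChanges : List Sign → ℕ
signChanges [] = 0
signChanges (s ∷ []) = 0
signChanges (S.+ ∷ S.+ ∷ xs) = signChanges (S.+ ∷ xs)
signChanges (S.- ∷ S.- ∷ xs) = signChanges (S.- ∷ xs)
signChanges (S.+ ∷ S.- ∷ xs) = suc (signChanges (S.- ∷ xs))
signChanges (S.- ∷ S.+ ∷ xs) = suc (signChanges (S.+ ∷ xs))

-- r-signotope on [n]: for every (r+1)-subset X = {x₁<…<x_{r+1}}, the sequence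
-- σ(X∖x₁), …, σ(X∖x_{r+1}) has at most one sign change.
IsSignotope : (n r : ℕ) → SignMap n → Set
IsSignotope n r σ =
  (X : Subset n) → ∣ X ∣ ≡ suc r →
  signChanges (map (λ x → σ (X - x)) (elems X)) ≤ 1

-- x, y are consecutive elements x_j, x_{j+1} in the list.
Consecutive : ∀ {A : Set} → A → A → List A → Set
Consecutive {A} x y l = Σ (List A) λ pre → Σ (List A) λ suf → l ≡ pre ++ (x ∷ y ∷ suf)

-- Generating relation A ≺ B on (r-1)-subsets: for an r-subset X = {x₁<…<x_r}
-- with consecutive elements x_j, x_{j+1}:
--   σ(X) = +  gives  X_j ≻ X_{j+1}, i.e.  X∖x_{j+1} ≺ X∖x_j ;
--   σ(X) = -  gives  X_j ≺ X_{j+1}, i.e.  X∖x_j ≺ X∖x_{j+1}.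
data Step (n r : ℕ) (σ : SignMap n) : Subset n → Subset n → Set where
  step+ : (X : Subset n) → ∣ X ∣ ≡ r → (x y : Fin n) → Consecutive x y (elems X) →
          σ X ≡ S.+ → Step n r σ (X - y) (X - x)
  step- : (X : Subset n) → ∣ X ∣ ≡ r → (x y : Fin n) → Consecutive x y (elems X) →
          σ X ≡ S.- → Step n r σ (X - x) (X - y)

-- The partial order ≺ corresponding to σ: transitive closure of Step.
Prec : (n r : ℕ) → SignMap n → Subset n → Subset n → Set
Prec n r σ = TransClosure (Step n r σ)

-- x_rot = x - 1 for x ≠ 1, and 1_rot = n.
rotElem : ∀ {n} → Fin n → Fin n
rotElem {suc n} zero = fromℕ n
rotElem {suc n} (suc i) = inject₁ i

-- X_rot = { x_rot : x ∈ X }.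
rotSubset : ∀ {n} → Subset n → Subset n
rotSubset X = tabulate (λ y → any (λ x → does (rotElem x ≟ y)) (elems X))

-- For an r-subset X = {x₁<…<x_r}:  σ_rot(X) = -σ(1, x₁+1, …, x_{r-1}+1) if x_r = n,
-- and σ(x₁+1, …, x_r+1) otherwise.  The set {x+1 …} (with n+1 read as 1) is the
-- preimage { y : y_rot ∈ X }.
rotSignMap : ∀ {n} → SignMap n → SignMap n
rotSignMap {zero} σ X = σ X
rotSignMap {suc n} σ X =
  let Y = tabulate (λ y → lookup X (rotElem y)) in
  if lookup X (fromℕ n) then opposite (σ Y) else σ Y

{-# OPTIONS --safe #-}
module Submission where

open import Defs
open import Data.Nat using (ℕ; zero; suc; _+_; _*_; _^_; _≤_; _<_; z≤n; s≤s)
open import Data.Nat.Properties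
  using (≤-refl; ≤-trans; <-asym; <-trans; <-cmp; n≤1+n; m≤m+n; 1+n≰n; +-mono-≤-<; +-monoʳ-<;
         +-assoc; +-identityʳ; +-comm; +-suc; +-cancelʳ-≡; suc-injective)
open import Data.Fin using (Fin; zero; suc; toℕ; fromℕ; inject₁; _≟_)
open import Data.Fin.Properties
  using (toℕ-injective; toℕ-inject₁; toℕ-fromℕ; toℕ<n; inject₁-injective; fromℕ≢inject₁)
  renaming (suc-injective to Fin-suc-injective)
open import Data.Fin.Subset using (Subset; inside; outside; _∈_; _∉_; _∩_; _-_; ∣_∣)
open import Data.Fin.Subset.Properties using (_∈?_; p─⊥≡p; ∩-comm; ∣p∩q∣≤∣p∣)
open import Data.List using (List; []; _∷_; _++_; map; filter; tabulate; allFin)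
open import Data.List.Properties using (map-++; map-∘; ++-assoc; ∷-injectiveʳ)
open import Data.List.Membership.Propositional using (find; lose) renaming (_∈_ to _∈ₗ_)
open import Data.List.Membership.Propositional.Properties using (∈-filter⁺; ∈-filter⁻; ∈-allFin; ∈-∃++)
open import Data.List.Relation.Unary.Any.Properties using (any⁺; any⁻)
open import Data.Bool using (Bool; true; false; T; if_then_else_)
open import Data.Bool.ListAction using (any)
open import Data.Bool.Properties using (T-≡; ⇔→≡)
open import Data.Vec using ([]; _∷_; _∷ʳ_; lookup; here; there)
import Data.Vec as Vec
open import Data.Vec.Properties
  using (tabulate∘lookup; tabulate-cong; lookup∘tabulate; []=⇒lookup; lookup⇒[]=)
open import Data.Sign using (Sign; opposite)
import Data.Sign as S
open import Data.Product using (∃; ∃₂; _×_; _,_; proj₂)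
import Data.Product as Product
open import Data.Sum using (_⊎_; inj₁; inj₂; swap)
open import Data.Empty using (⊥; ⊥-elim)
open import Function using (_∘_; Equivalence; mk⇔)
open import Relation.Binary using (tri<; tri≈; tri>)
open import Relation.Binary.Construct.Closure.Transitive using ([_])
import Relation.Binary.Construct.Closure.Transitive as TC
open import Relation.Binary.PropositionalEquality
open import Relation.Nullary using (does; yes; no)
open import Relation.Nullary.Decidable using (toWitness; isYes≗does; dec-true)

-- I and J are the facets X ∖ b and X ∖ a of the r-set X = I ∪ J.  The order of a signotope
-- is acyclic: a rank function built by recursion on the first element of [n] increases
-- along every generating step.  Hence I ≺ J forces the orientation that X itself generates,
-- namely a < b if σ(X) = + and b < a if σ(X) = -.  Rotation preserves the order of the
-- elements other than 1 and makes 1 the largest, while it flips σ(X) exactly when 1 ∈ X;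
-- the two effects cancel unless 1 ∈ I ∩ J.

filter-∈?-tabulate-suc : ∀ {k m} (f : Fin k → Fin m) b (X : Subset m) →
  filter (λ i → i ∈? b ∷ X) (tabulate (suc ∘ f)) ≡ map suc (filter (λ i → i ∈? X) (tabulate f))
filter-∈?-tabulate-suc {zero} f b X = refl
filter-∈?-tabulate-suc {suc k} f b X with does (f zero ∈? X)
... | true = cong (suc (f zero) ∷_) (filter-∈?-tabulate-suc (f ∘ suc) b X)
... | false = filter-∈?-tabulate-suc (f ∘ suc) b X

elems-outside-∷ : ∀ {m} (X : Subset m) → elems (outside ∷ X) ≡ map suc (elems X)
elems-outside-∷ X = filter-∈?-tabulate-suc (λ i → i) outside X

elems-inside-∷ : ∀ {m} (X : Subset m) → elems (inside ∷ X) ≡ zero ∷ map suc (elems X)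
elems-inside-∷ X = cong (zero ∷_) (filter-∈?-tabulate-suc (λ i → i) inside X)

∈⇒∈-elems : ∀ {m} {X : Subset m} {x} → x ∈ X → x ∈ₗ elems X
∈⇒∈-elems {X = X} {x} x∈X = ∈-filter⁺ (_∈? X) (∈-allFin x) x∈X

∈-elems⇒∈ : ∀ {m} {X : Subset m} {x} → x ∈ₗ elems X → x ∈ X
∈-elems⇒∈ {m} {X} x∈ = proj₂ (∈-filter⁻ (_∈? X) {xs = allFin m} x∈)

∷-minus-zero : ∀ {m} b (X : Subset m) → (b ∷ X) - zero ≡ outside ∷ X
∷-minus-zero b X = cong (outside ∷_) (p─⊥≡p X)

Precedes : ∀ {A : Set} → A → A → List A → Set
Precedes x y l = ∃₂ λ pre mid → ∃ λ suf → l ≡ pre ++ x ∷ mid ++ y ∷ suf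

Precedes-map : ∀ {A B : Set} (f : A → B) {x y l} → Precedes x y l → Precedes (f x) (f y) (map f l)
Precedes-map f {x} (pre , mid , suf , refl) = map f pre , map f mid , map f suf ,
  trans (map-++ f pre _) (cong (λ t → map f pre ++ f x ∷ t) (map-++ f mid _))

<⇒Precedes : ∀ {m} {X : Subset m} {x y} → x ∈ X → y ∈ X → toℕ x < toℕ y → Precedes x y (elems X)
<⇒Precedes here here ()
<⇒Precedes (there _) here ()
<⇒Precedes {X = inside ∷ X} here (there y∈X) _ with ∈-∃++ (∈⇒∈-elems y∈X)
... | mid , suf , e = [] , map suc mid , map suc suf ,
  trans (elems-inside-∷ X) (cong (zero ∷_) (trans (cong (map suc) e) (map-++ suc mid _)))
<⇒Precedes {X = outside ∷ X} (there x∈X) (there y∈X) (s≤s x<y) =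
  subst (Precedes _ _) (sym (elems-outside-∷ X)) (Precedes-map suc (<⇒Precedes x∈X y∈X x<y))
<⇒Precedes {X = inside ∷ X} (there x∈X) (there y∈X) (s≤s x<y)
  with Precedes-map suc (<⇒Precedes x∈X y∈X x<y)
... | pre , mid , suf , e = zero ∷ pre , mid , suf , trans (elems-inside-∷ X) (cong (zero ∷_) e)

Consecutive-map⁻ : ∀ {A B : Set} (f : A → B) {x y} (E : List A) → Consecutive x y (map f E) →
  ∃₂ λ x′ y′ → x ≡ f x′ × y ≡ f y′ × Consecutive x′ y′ E
Consecutive-map⁻ f [] ([] , _ , ())
Consecutive-map⁻ f [] (_ ∷ _ , _ , ())
Consecutive-map⁻ f (_ ∷ []) ([] , _ , ())
Consecutive-map⁻ f (e₁ ∷ e₂ ∷ E) ([] , _ , refl) = e₁ , e₂ , refl , refl , [] , E , refl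
Consecutive-map⁻ f (e ∷ E) (_ ∷ pre , suf , eq) with Consecutive-map⁻ f E (pre , suf , ∷-injectiveʳ eq)
... | x′ , y′ , refl , refl , pre′ , suf′ , eq′ =
  x′ , y′ , refl , refl , e ∷ pre′ , suf′ , cong (e ∷_) eq′

Consecutive-zero∷map-suc⁻ : ∀ {m} {x y : Fin (suc m)} (E : List (Fin m)) →
  Consecutive x y (zero ∷ map suc E) →
  (x ≡ zero × ∃ λ y′ → y ≡ suc y′) ⊎ (∃₂ λ x′ y′ → x ≡ suc x′ × y ≡ suc y′ × Consecutive x′ y′ E)
Consecutive-zero∷map-suc⁻ [] ([] , _ , ())
Consecutive-zero∷map-suc⁻ (e ∷ E) ([] , _ , refl) = inj₁ (refl , e , refl)
Consecutive-zero∷map-suc⁻ E (_ ∷ pre , suf , eq) =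
  inj₂ (Consecutive-map⁻ suc E (pre , suf , ∷-injectiveʳ eq))

-- Sign changes

signChanges-∷-≤ : ∀ s l → signChanges l ≤ signChanges (s ∷ l)
signChanges-∷-≤ s [] = z≤n
signChanges-∷-≤ S.+ (S.+ ∷ l) = ≤-refl
signChanges-∷-≤ S.- (S.- ∷ l) = ≤-refl
signChanges-∷-≤ S.+ (S.- ∷ l) = n≤1+n _
signChanges-∷-≤ S.- (S.+ ∷ l) = n≤1+n _

signChanges-++-≤ : ∀ pre l → signChanges l ≤ signChanges (pre ++ l)
signChanges-++-≤ [] l = ≤-refl
signChanges-++-≤ (s ∷ pre) l = ≤-trans (signChanges-++-≤ pre l) (signChanges-∷-≤ s (pre ++ l))

signChanges-≢ : ∀ {u v} l → u ≢ v → 1 ≤ signChanges (u ∷ v ∷ l)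
signChanges-≢ {S.+} {S.+} l u≢v = ⊥-elim (u≢v refl)
signChanges-≢ {S.-} {S.-} l u≢v = ⊥-elim (u≢v refl)
signChanges-≢ {S.+} {S.-} l _ = s≤s z≤n
signChanges-≢ {S.-} {S.+} l _ = s≤s z≤n

≡-before-change : ∀ s t l → signChanges (s ∷ t ∷ l) ≤ 1 → 1 ≤ signChanges (t ∷ l) → s ≡ t
≡-before-change S.+ S.+ l _ _ = refl
≡-before-change S.- S.- l _ _ = refl
≡-before-change S.+ S.- l (s≤s le) pos = ⊥-elim (1+n≰n (≤-trans pos le))
≡-before-change S.- S.+ l (s≤s le) pos = ⊥-elim (1+n≰n (≤-trans pos le))

head-before-change : ∀ s pre {u v} suf → signChanges (s ∷ pre ++ u ∷ v ∷ suf) ≤ 1 → u ≢ v → s ≡ u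
head-before-change s [] suf le u≢v = ≡-before-change s _ _ le (signChanges-≢ suf u≢v)
head-before-change s (p ∷ pre) {u} {v} suf le u≢v =
  trans (≡-before-change s p rest le
           (≤-trans (signChanges-≢ suf u≢v) (signChanges-++-≤ (p ∷ pre) (u ∷ v ∷ suf))))
        (head-before-change p pre suf (≤-trans (signChanges-∷-≤ s (p ∷ rest)) le) u≢v)
  where
  rest : List Sign
  rest = pre ++ u ∷ v ∷ suf

-- Deleting and contracting the element 1

signs : ∀ {n} → SignMap n → Subset n → List Sign
signs σ X = map (λ x → σ (X - x)) (elems X)

signs-outside-∷ : ∀ {m} (σ : SignMap (suc m)) X → signs σ (outside ∷ X) ≡ signs (σ ∘ (outside ∷_)) X
signs-outside-∷ σ X =
  trans (cong (map (λ x → σ ((outside ∷ X) - x))) (elems-outside-∷ X)) (sym (map-∘ (elems X)))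

signs-inside-∷ : ∀ {m} (σ : SignMap (suc m)) X →
  signs σ (inside ∷ X) ≡ σ (outside ∷ X) ∷ signs (σ ∘ (inside ∷_)) X
signs-inside-∷ σ X = trans (cong (map (λ x → σ ((inside ∷ X) - x))) (elems-inside-∷ X))
  (cong₂ _∷_ (cong σ (∷-minus-zero inside X)) (sym (map-∘ (elems X))))

IsSignotope-outside : ∀ {m r σ} → IsSignotope (suc m) r σ → IsSignotope m r (σ ∘ (outside ∷_))
IsSignotope-outside {σ = σ} sig X ∣X∣ =
  subst (λ l → signChanges l ≤ 1) (signs-outside-∷ σ X) (sig (outside ∷ X) ∣X∣)

signChanges-signs-inside-∷ : ∀ {m r σ} → IsSignotope (suc m) r σ → ∀ X → ∣ X ∣ ≡ r →
  signChanges (σ (outside ∷ X) ∷ signs (σ ∘ (inside ∷_)) X) ≤ 1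
signChanges-signs-inside-∷ {σ = σ} sig X ∣X∣ =
  subst (λ l → signChanges l ≤ 1) (signs-inside-∷ σ X) (sig (inside ∷ X) (cong suc ∣X∣))

IsSignotope-inside : ∀ {m r σ} → IsSignotope (suc m) (suc r) σ → IsSignotope m r (σ ∘ (inside ∷_))
IsSignotope-inside {σ = σ} sig X ∣X∣ =
  ≤-trans (signChanges-∷-≤ (σ (outside ∷ X)) (signs (σ ∘ (inside ∷_)) X))
          (signChanges-signs-inside-∷ {σ = σ} sig X ∣X∣)

sign-before-change : ∀ {m r σ} → IsSignotope (suc m) r σ → ∀ {X : Subset m} {x y} → ∣ X ∣ ≡ r →
  Consecutive x y (elems X) → σ (inside ∷ (X - x)) ≢ σ (inside ∷ (X - y)) →
  σ (outside ∷ X) ≡ σ (inside ∷ (X - x))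
sign-before-change {σ = σ} sig {X} ∣X∣ (pre , suf , e) =
  head-before-change (σ (outside ∷ X)) (map τ pre) (map τ suf)
    (subst (λ l → signChanges (σ (outside ∷ X) ∷ l) ≤ 1)
      (trans (cong (map τ) e) (map-++ τ pre _)) (signChanges-signs-inside-∷ {σ = σ} sig X ∣X∣))
  where
  τ : Fin _ → Sign
  τ z = σ (inside ∷ (X - z))

-- Acyclicity

weight : ℕ → Sign → ℕ
weight B S.- = 0
weight B S.+ = B + B

-- Sets containing 1 form the middle band; a set K ∌ 1 lies below it if σ(K ∪ {1}) = - and
-- above it if σ(K ∪ {1}) = +, the direction of the step between K and (K ∪ {1}) ∖ y.
-- Within a band the rank is computed recursively on [2, n].
rank : ∀ {n} → SignMap n → Subset n → ℕ
rank {zero} σ K = 0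
rank {suc m} σ (outside ∷ K) = weight (3 ^ m) (σ (inside ∷ K)) + rank (σ ∘ (outside ∷_)) K
rank {suc m} σ (inside ∷ K) = 3 ^ m + rank (σ ∘ (inside ∷_)) K

weight≤ : ∀ B s → weight B s ≤ B + B
weight≤ B S.- = z≤n
weight≤ B S.+ = ≤-refl

weight-≤⁺ : ∀ B {u v} → (u ≢ v → u ≡ S.+) → weight B v ≤ weight B u
weight-≤⁺ B {S.+} {v} _ = weight≤ B v
weight-≤⁺ B {S.-} {S.-} _ = ≤-refl
weight-≤⁺ B {S.-} {S.+} h with h (λ ())
... | ()

weight-≤⁻ : ∀ B {u v} → (u ≢ v → u ≡ S.-) → weight B u ≤ weight B v
weight-≤⁻ B {S.-} _ = z≤n
weight-≤⁻ B {S.+} {S.+} _ = ≤-refl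
weight-≤⁻ B {S.+} {S.-} h with h (λ ())
... | ()

+-triple : ∀ B → B + B + B ≡ 3 * B
+-triple B = trans (+-assoc B B B) (cong (λ t → B + (B + t)) (sym (+-identityʳ B)))

rank<3^n : ∀ {n} (σ : SignMap n) K → rank σ K < 3 ^ n
rank<3^n {zero} σ K = s≤s z≤n
rank<3^n {suc m} σ (outside ∷ K) = subst (rank σ (outside ∷ K) <_) (+-triple (3 ^ m))
  (+-mono-≤-< (weight≤ (3 ^ m) (σ (inside ∷ K))) (rank<3^n (σ ∘ (outside ∷_)) K))
rank<3^n {suc m} σ (inside ∷ K) = subst (rank σ (inside ∷ K) <_) (+-triple (3 ^ m))
  (+-mono-≤-< (m≤m+n (3 ^ m) (3 ^ m)) (rank<3^n (σ ∘ (inside ∷_)) K))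

rank-inside<rank-outside : ∀ {m} (σ : SignMap (suc m)) K L → σ (inside ∷ L) ≡ S.+ →
  rank σ (inside ∷ K) < rank σ (outside ∷ L)
rank-inside<rank-outside {m} σ K L σL rewrite σL =
  ≤-trans (+-monoʳ-< (3 ^ m) (rank<3^n (σ ∘ (inside ∷_)) K)) (m≤m+n (3 ^ m + 3 ^ m) _)

rank-outside<rank-inside : ∀ {m} (σ : SignMap (suc m)) K L → σ (inside ∷ L) ≡ S.- →
  rank σ (outside ∷ L) < rank σ (inside ∷ K)
rank-outside<rank-inside {m} σ K L σL rewrite σL =
  ≤-trans (rank<3^n (σ ∘ (outside ∷_)) L) (m≤m+n (3 ^ m) _)

Step⇒rank< : ∀ {n r σ A B} → IsSignotope n r σ → Step n r σ A B → rank σ A < rank σ B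
Step⇒rank< {zero} _ (step+ _ _ () _ _ _)
Step⇒rank< {zero} _ (step- _ _ () _ _ _)
Step⇒rank< {suc m} {σ = σ} sig (step+ (outside ∷ X) ∣X∣ x y c σX)
  with Consecutive-map⁻ suc (elems X) (subst (Consecutive x y) (elems-outside-∷ X) c)
... | x′ , y′ , refl , refl , c′ =
  +-mono-≤-< (weight-≤⁺ (3 ^ m) (λ ne → trans (sym (sign-before-change {σ = σ} sig ∣X∣ c′ ne)) σX))
             (Step⇒rank< (IsSignotope-outside {σ = σ} sig) (step+ X ∣X∣ x′ y′ c′ σX))
Step⇒rank< {suc m} {σ = σ} sig (step- (outside ∷ X) ∣X∣ x y c σX)
  with Consecutive-map⁻ suc (elems X) (subst (Consecutive x y) (elems-outside-∷ X) c)
... | x′ , y′ , refl , refl , c′ =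
  +-mono-≤-< (weight-≤⁻ (3 ^ m) (λ ne → trans (sym (sign-before-change {σ = σ} sig ∣X∣ c′ ne)) σX))
             (Step⇒rank< (IsSignotope-outside {σ = σ} sig) (step- X ∣X∣ x′ y′ c′ σX))
Step⇒rank< {suc m} {σ = σ} sig (step+ (inside ∷ X) ∣X∣ x y c σX)
  with Consecutive-zero∷map-suc⁻ (elems X) (subst (Consecutive x y) (elems-inside-∷ X) c)
... | inj₁ (refl , y′ , refl) = subst (λ Z → rank σ (inside ∷ (X - y′)) < rank σ Z)
  (sym (∷-minus-zero inside X)) (rank-inside<rank-outside σ (X - y′) X σX)
... | inj₂ (x′ , y′ , refl , refl , c′) with ∣X∣
...   | refl = +-monoʳ-< (3 ^ m) (Step⇒rank< (IsSignotope-inside {σ = σ} sig) (step+ X refl x′ y′ c′ σX))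
Step⇒rank< {suc m} {σ = σ} sig (step- (inside ∷ X) ∣X∣ x y c σX)
  with Consecutive-zero∷map-suc⁻ (elems X) (subst (Consecutive x y) (elems-inside-∷ X) c)
... | inj₁ (refl , y′ , refl) = subst (λ Z → rank σ Z < rank σ (inside ∷ (X - y′)))
  (sym (∷-minus-zero inside X)) (rank-outside<rank-inside σ (X - y′) X σX)
... | inj₂ (x′ , y′ , refl , refl , c′) with ∣X∣
...   | refl = +-monoʳ-< (3 ^ m) (Step⇒rank< (IsSignotope-inside {σ = σ} sig) (step- X refl x′ y′ c′ σX))

Prec⇒rank< : ∀ {n r σ A B} → IsSignotope n r σ → Prec n r σ A B → rank σ A < rank σ B
Prec⇒rank< sig [ s ] = Step⇒rank< sig s
Prec⇒rank< sig (s TC.∷ p) = <-trans (Step⇒rank< sig s) (Prec⇒rank< sig p)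

Prec-asym : ∀ {n r σ A B} → IsSignotope n r σ → Prec n r σ A B → Prec n r σ B A → ⊥
Prec-asym sig p q = <-asym (Prec⇒rank< sig p) (Prec⇒rank< sig q)

Precedes⇒Prec⁺ : ∀ {n r σ} {X : Subset n} {x y} → ∣ X ∣ ≡ r → σ X ≡ S.+ →
  Precedes x y (elems X) → Prec n r σ (X - y) (X - x)
Precedes⇒Prec⁺ {n} {r} {σ} {X} ∣X∣ σX (pre , mid , suf , e) = chain pre mid e
  where
  chain : ∀ {x y} pre mid → elems X ≡ pre ++ x ∷ mid ++ y ∷ suf → Prec n r σ (X - y) (X - x)
  chain pre [] e = [ step+ X ∣X∣ _ _ (pre , suf , e) σX ]
  chain {x} pre (z ∷ mid) e =
    chain (pre ++ x ∷ []) mid (trans e (sym (++-assoc pre (x ∷ []) _)))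
    TC.∷ʳ step+ X ∣X∣ x z (pre , mid ++ _ ∷ suf , e) σX

Precedes⇒Prec⁻ : ∀ {n r σ} {X : Subset n} {x y} → ∣ X ∣ ≡ r → σ X ≡ S.- →
  Precedes x y (elems X) → Prec n r σ (X - x) (X - y)
Precedes⇒Prec⁻ {n} {r} {σ} {X} ∣X∣ σX (pre , mid , suf , e) = chain pre mid e
  where
  chain : ∀ {x y} pre mid → elems X ≡ pre ++ x ∷ mid ++ y ∷ suf → Prec n r σ (X - x) (X - y)
  chain pre [] e = [ step- X ∣X∣ _ _ (pre , suf , e) σX ]
  chain {x} pre (z ∷ mid) e =
    step- X ∣X∣ x z (pre , mid ++ _ ∷ suf , e) σX
    TC.∷ chain (pre ++ x ∷ []) mid (trans e (sym (++-assoc pre (x ∷ []) _)))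

-- Oriented (σ X) a b: the facets of X are ordered so that X ∖ b ≺ X ∖ a.
Oriented : ∀ {n} → Sign → Fin n → Fin n → Set
Oriented S.+ a b = toℕ a < toℕ b
Oriented S.- a b = toℕ b < toℕ a

Oriented-total : ∀ {n} s {a b : Fin n} → a ≢ b → Oriented s a b ⊎ Oriented s b a
Oriented-total S.+ {a} {b} a≢b with <-cmp (toℕ a) (toℕ b)
... | tri< a<b _ _ = inj₁ a<b
... | tri≈ _ a≡b _ = ⊥-elim (a≢b (toℕ-injective a≡b))
... | tri> _ _ b<a = inj₂ b<a
Oriented-total S.- a≢b = swap (Oriented-total S.+ a≢b)

Oriented-opposite : ∀ {n} s {a b : Fin n} → Oriented s a b → Oriented (opposite s) b a
Oriented-opposite S.+ o = o
Oriented-opposite S.- o = o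

Oriented⇒Prec : ∀ {n r} (σ : SignMap n) {X a b} → ∣ X ∣ ≡ r → a ∈ X → b ∈ X →
  Oriented (σ X) a b → Prec n r σ (X - b) (X - a)
Oriented⇒Prec σ {X} ∣X∣ a∈X b∈X o with σ X in σX
... | S.+ = Precedes⇒Prec⁺ ∣X∣ σX (<⇒Precedes a∈X b∈X o)
... | S.- = Precedes⇒Prec⁻ ∣X∣ σX (<⇒Precedes b∈X a∈X o)

Prec⇒Oriented : ∀ {n r σ X a b} → IsSignotope n r σ → ∣ X ∣ ≡ r → a ∈ X → b ∈ X → a ≢ b →
  Prec n r σ (X - b) (X - a) → Oriented (σ X) a b
Prec⇒Oriented {σ = σ} {X} sig ∣X∣ a∈X b∈X a≢b X∖b≺X∖a with Oriented-total (σ X) a≢b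
... | inj₁ o = o
... | inj₂ o = ⊥-elim (Prec-asym sig X∖b≺X∖a (Oriented⇒Prec σ ∣X∣ b∈X a∈X o))

-- Rotation

rotElem-injective : ∀ {m} {x y : Fin (suc m)} → rotElem x ≡ rotElem y → x ≡ y
rotElem-injective {x = zero} {zero} _ = refl
rotElem-injective {x = zero} {suc j} e = ⊥-elim (fromℕ≢inject₁ e)
rotElem-injective {x = suc i} {zero} e = ⊥-elim (fromℕ≢inject₁ (sym e))
rotElem-injective {x = suc i} {suc j} e = cong suc (inject₁-injective e)

rotElem-surjective : ∀ {m} (y : Fin (suc m)) → ∃ λ x → rotElem x ≡ y
rotElem-surjective {zero} zero = zero , refl
rotElem-surjective {suc m} zero = suc zero , refl
rotElem-surjective {suc m} (suc y) with rotElem-surjective y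
... | zero , e = zero , cong suc e
... | suc i , e = suc (suc i) , cong suc e

lookup-rotSubset : ∀ {m} (X : Subset (suc m)) x → lookup (rotSubset X) (rotElem x) ≡ lookup X x
lookup-rotSubset X x = trans (lookup∘tabulate (λ y → any (λ z → does (rotElem z ≟ y)) (elems X)) (rotElem x))
                             (⇔→≡ (mk⇔ to from))
  where
  p : Fin _ → Bool
  p z = does (rotElem z ≟ rotElem x)
  p⇒≡ : ∀ {z} → T (p z) → z ≡ x
  p⇒≡ {z} pz = rotElem-injective (toWitness (subst T (sym (isYes≗does (rotElem z ≟ rotElem x))) pz))
  to : any p (elems X) ≡ true → lookup X x ≡ true
  to h = let z , z∈ , pz = find (any⁻ p (elems X) (Equivalence.from T-≡ h))
         in subst (λ y → lookup X y ≡ true) (p⇒≡ pz) ([]=⇒lookup (∈-elems⇒∈ {X = X} z∈))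
  from : lookup X x ≡ true → any p (elems X) ≡ true
  from h = Equivalence.to T-≡ (any⁺ p (lose (∈⇒∈-elems (lookup⇒[]= x X h))
                                            (Equivalence.from T-≡ (dec-true (rotElem x ≟ rotElem x) refl))))

∈-rotSubset : ∀ {m} {X : Subset (suc m)} {x} → x ∈ X → rotElem x ∈ rotSubset X
∈-rotSubset {X = X} {x} x∈X =
  lookup⇒[]= (rotElem x) (rotSubset X) (trans (lookup-rotSubset X x) ([]=⇒lookup x∈X))

rotElem-ext : ∀ {m} {U V : Subset (suc m)} → (∀ x → lookup U (rotElem x) ≡ lookup V (rotElem x)) → U ≡ V
rotElem-ext {U = U} {V} h = begin
  U                     ≡⟨ tabulate∘lookup U ⟨
  Vec.tabulate (lookup U) ≡⟨ tabulate-cong pointwise ⟩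
  Vec.tabulate (lookup V) ≡⟨ tabulate∘lookup V ⟩
  V                     ∎
  where
  open ≡-Reasoning
  pointwise : ∀ y → lookup U y ≡ lookup V y
  pointwise y with rotElem-surjective y
  ... | x , refl = h x

lookup-minus-self : ∀ {m} (p : Subset m) x → lookup (p - x) x ≡ outside
lookup-minus-self (b ∷ p) zero = refl
lookup-minus-self (b ∷ p) (suc x) = lookup-minus-self p x

lookup-minus-other : ∀ {m} (p : Subset m) {x y} → y ≢ x → lookup (p - x) y ≡ lookup p y
lookup-minus-other (b ∷ p) {zero} {zero} y≢x = ⊥-elim (y≢x refl)
lookup-minus-other (b ∷ p) {zero} {suc y} _ = cong (λ q → lookup q (suc y)) (∷-minus-zero b p)
lookup-minus-other (b ∷ p) {suc x} {zero} _ = refl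
lookup-minus-other (b ∷ p) {suc x} {suc y} y≢x = lookup-minus-other p (y≢x ∘ cong suc)

rotSubset-minus : ∀ {m} (X : Subset (suc m)) b → rotSubset (X - b) ≡ rotSubset X - rotElem b
rotSubset-minus X b = rotElem-ext pointwise
  where
  open ≡-Reasoning
  pointwise : ∀ x → lookup (rotSubset (X - b)) (rotElem x) ≡ lookup (rotSubset X - rotElem b) (rotElem x)
  pointwise x with x ≟ b
  ... | yes refl = begin
    lookup (rotSubset (X - x)) (rotElem x) ≡⟨ lookup-rotSubset (X - x) x ⟩
    lookup (X - x) x                       ≡⟨ lookup-minus-self X x ⟩
    outside                                ≡⟨ lookup-minus-self (rotSubset X) (rotElem x) ⟨
    lookup (rotSubset X - rotElem x) (rotElem x) ∎
  ... | no x≢b = begin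
    lookup (rotSubset (X - b)) (rotElem x) ≡⟨ lookup-rotSubset (X - b) x ⟩
    lookup (X - b) x                       ≡⟨ lookup-minus-other X x≢b ⟩
    lookup X x                             ≡⟨ lookup-rotSubset X x ⟨
    lookup (rotSubset X) (rotElem x)       ≡⟨ lookup-minus-other (rotSubset X) (x≢b ∘ rotElem-injective) ⟨
    lookup (rotSubset X - rotElem b) (rotElem x) ∎

preimage-rotSubset : ∀ {m} (X : Subset (suc m)) →
  Vec.tabulate (λ y → lookup (rotSubset X) (rotElem y)) ≡ X
preimage-rotSubset X = trans (tabulate-cong (lookup-rotSubset X)) (tabulate∘lookup X)

rotSignMap-rotSubset : ∀ {m} (σ : SignMap (suc m)) X →
  rotSignMap σ (rotSubset X) ≡ (if lookup X zero then opposite (σ X) else σ X)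
rotSignMap-rotSubset σ X rewrite preimage-rotSubset X | lookup-rotSubset X zero = refl

lookup-∷ʳ-last : ∀ {m} (xs : Subset m) b → lookup (xs ∷ʳ b) (fromℕ m) ≡ b
lookup-∷ʳ-last [] b = refl
lookup-∷ʳ-last (x ∷ xs) b = lookup-∷ʳ-last xs b

lookup-∷ʳ-inject₁ : ∀ {m} (xs : Subset m) b i → lookup (xs ∷ʳ b) (inject₁ i) ≡ lookup xs i
lookup-∷ʳ-inject₁ (x ∷ xs) b zero = refl
lookup-∷ʳ-inject₁ (x ∷ xs) b (suc i) = lookup-∷ʳ-inject₁ xs b i

rotSubset-∷ : ∀ {m} b (X : Subset m) → rotSubset (b ∷ X) ≡ X ∷ʳ b
rotSubset-∷ b X = rotElem-ext pointwise
  where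
  pointwise : ∀ x → lookup (rotSubset (b ∷ X)) (rotElem x) ≡ lookup (X ∷ʳ b) (rotElem x)
  pointwise zero = trans (lookup-rotSubset (b ∷ X) zero) (sym (lookup-∷ʳ-last X b))
  pointwise (suc i) = trans (lookup-rotSubset (b ∷ X) (suc i)) (sym (lookup-∷ʳ-inject₁ X b i))

∣∷ʳ∣ : ∀ {m} (xs : Subset m) b → ∣ xs ∷ʳ b ∣ ≡ ∣ b ∷ xs ∣
∣∷ʳ∣ [] b = refl
∣∷ʳ∣ (inside ∷ xs) inside = cong suc (∣∷ʳ∣ xs inside)
∣∷ʳ∣ (inside ∷ xs) outside = cong suc (∣∷ʳ∣ xs outside)
∣∷ʳ∣ (outside ∷ xs) inside = ∣∷ʳ∣ xs inside
∣∷ʳ∣ (outside ∷ xs) outside = ∣∷ʳ∣ xs outside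

∣rotSubset∣ : ∀ {m} (X : Subset (suc m)) → ∣ rotSubset X ∣ ≡ ∣ X ∣
∣rotSubset∣ (b ∷ X) = trans (cong ∣_∣ (rotSubset-∷ b X)) (∣∷ʳ∣ X b)

rotElem-suc-< : ∀ {m} {i j : Fin m} → toℕ (suc i) < toℕ (suc j) →
  toℕ (rotElem {suc m} (suc i)) < toℕ (rotElem {suc m} (suc j))
rotElem-suc-< {i = i} {j} (s≤s i<j) rewrite toℕ-inject₁ i | toℕ-inject₁ j = i<j

rotElem-suc<rotElem-zero : ∀ {m} (i : Fin m) → toℕ (rotElem {suc m} (suc i)) < toℕ (rotElem {suc m} zero)
rotElem-suc<rotElem-zero {m} i rewrite toℕ-inject₁ i | toℕ-fromℕ m = toℕ<n i

Oriented-rotElem-suc : ∀ {m} s {i j : Fin m} → Oriented s (suc i) (suc j) →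
  Oriented s (rotElem {suc m} (suc i)) (rotElem (suc j))
Oriented-rotElem-suc S.+ o = rotElem-suc-< o
Oriented-rotElem-suc S.- o = rotElem-suc-< o

Oriented-rotate : ∀ {m} s {X : Subset (suc m)} {a b} → a ∈ X → b ∈ X → a ≢ b → Oriented s a b →
  (zero ∉ (X - b) ∩ (X - a) → Oriented (if lookup X zero then opposite s else s) (rotElem a) (rotElem b)) ×
  (zero ∈ (X - b) ∩ (X - a) → Oriented (if lookup X zero then opposite s else s) (rotElem b) (rotElem a))
Oriented-rotate s {a = zero} {zero} _ _ a≢b _ = ⊥-elim (a≢b refl)
Oriented-rotate S.+ {a = zero} {suc j} here _ _ _ = (λ _ → rotElem-suc<rotElem-zero j) , λ ()
Oriented-rotate S.- {a = zero} {suc j} here _ _ ()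
Oriented-rotate S.- {a = suc i} {zero} _ here _ _ = (λ _ → rotElem-suc<rotElem-zero i) , λ ()
Oriented-rotate S.+ {a = suc i} {zero} _ here _ ()
Oriented-rotate s {outside ∷ X} {suc i} {suc j} _ _ _ o = (λ _ → Oriented-rotElem-suc s o) , λ ()
Oriented-rotate s {inside ∷ X} {suc i} {suc j} _ _ _ o =
  (λ 1∉ → ⊥-elim (1∉ here)) , (λ _ → Oriented-opposite s (Oriented-rotElem-suc s o))

Oriented⇒Prec-rot : ∀ {m r} (σ : SignMap (suc m)) {X a b} → ∣ X ∣ ≡ r → a ∈ X → b ∈ X →
  Oriented (if lookup X zero then opposite (σ X) else σ X) (rotElem a) (rotElem b) →
  Prec (suc m) r (rotSignMap σ) (rotSubset (X - b)) (rotSubset (X - a))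
Oriented⇒Prec-rot σ {X} {a} {b} ∣X∣ a∈X b∈X o =
  subst₂ (Prec _ _ (rotSignMap σ)) (sym (rotSubset-minus X b)) (sym (rotSubset-minus X a))
    (Oriented⇒Prec (rotSignMap σ) (trans (∣rotSubset∣ X) ∣X∣) (∈-rotSubset a∈X) (∈-rotSubset b∈X)
      (subst (λ s → Oriented s (rotElem a) (rotElem b)) (sym (rotSignMap-rotSubset σ X)) o))

-- Two facets of one r-set

data Adjacent {n} : Subset n → Subset n → Set where
  adjacent : ∀ X {a b} → a ∈ X → b ∈ X → a ≢ b → Adjacent (X - b) (X - a)

Adjacent-∷ : ∀ {n} s {I J : Subset n} → Adjacent I J → Adjacent (s ∷ I) (s ∷ J)
Adjacent-∷ s (adjacent X a∈X b∈X a≢b) =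
  adjacent (s ∷ X) (there a∈X) (there b∈X) (a≢b ∘ Fin-suc-injective)

card-∩⇒≡ : ∀ {m k} (I J : Subset m) → ∣ I ∣ ≡ k → ∣ J ∣ ≡ k → ∣ I ∩ J ∣ ≡ k → I ≡ J
card-∩⇒≡ [] [] _ _ _ = refl
card-∩⇒≡ (inside ∷ I) (inside ∷ J) refl ∣J∣ ∣I∩J∣ =
  cong (inside ∷_) (card-∩⇒≡ I J refl (suc-injective ∣J∣) (suc-injective ∣I∩J∣))
card-∩⇒≡ (outside ∷ I) (outside ∷ J) ∣I∣ ∣J∣ ∣I∩J∣ = cong (outside ∷_) (card-∩⇒≡ I J ∣I∣ ∣J∣ ∣I∩J∣)
card-∩⇒≡ (inside ∷ I) (outside ∷ J) refl _ ∣I∩J∣ = ⊥-elim (1+n≰n (subst (_≤ ∣ I ∣) ∣I∩J∣ (∣p∩q∣≤∣p∣ I J)))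
card-∩⇒≡ (outside ∷ I) (inside ∷ J) _ refl ∣I∩J∣ =
  ⊥-elim (1+n≰n (subst (_≤ ∣ J ∣) (trans (cong ∣_∣ (∩-comm J I)) ∣I∩J∣) (∣p∩q∣≤∣p∣ J I)))

card-∩⇒≡-minus : ∀ {m k} (I J : Subset m) → ∣ I ∣ ≡ k → ∣ J ∣ ≡ suc k → ∣ I ∩ J ∣ ≡ k →
  ∃ λ b → b ∈ J × I ≡ J - b
card-∩⇒≡-minus [] [] _ () _
card-∩⇒≡-minus (inside ∷ I) (inside ∷ J) refl ∣J∣ ∣I∩J∣
  with card-∩⇒≡-minus I J refl (suc-injective ∣J∣) (suc-injective ∣I∩J∣)
... | b , b∈J , I≡J-b = suc b , there b∈J , cong (inside ∷_) I≡J-b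
card-∩⇒≡-minus (outside ∷ I) (outside ∷ J) ∣I∣ ∣J∣ ∣I∩J∣ with card-∩⇒≡-minus I J ∣I∣ ∣J∣ ∣I∩J∣
... | b , b∈J , I≡J-b = suc b , there b∈J , cong (outside ∷_) I≡J-b
card-∩⇒≡-minus (inside ∷ I) (outside ∷ J) refl _ ∣I∩J∣ =
  ⊥-elim (1+n≰n (subst (_≤ ∣ I ∣) ∣I∩J∣ (∣p∩q∣≤∣p∣ I J)))
card-∩⇒≡-minus (outside ∷ I) (inside ∷ J) ∣I∣ ∣J∣ ∣I∩J∣ =
  zero , here ,
  trans (cong (outside ∷_) (card-∩⇒≡ I J ∣I∣ (suc-injective ∣J∣) ∣I∩J∣)) (sym (∷-minus-zero inside J))

Adjacent-intro : ∀ {m k} (I J : Subset m) → ∣ I ∣ ≡ suc k → ∣ J ∣ ≡ suc k → ∣ I ∩ J ∣ ≡ k → Adjacent I J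
Adjacent-intro [] [] () _ _
Adjacent-intro (inside ∷ I) (inside ∷ J) ∣I∣ ∣J∣ refl =
  Adjacent-∷ inside (Adjacent-intro I J (suc-injective ∣I∣) (suc-injective ∣J∣) refl)
Adjacent-intro (outside ∷ I) (outside ∷ J) ∣I∣ ∣J∣ ∣I∩J∣ =
  Adjacent-∷ outside (Adjacent-intro I J ∣I∣ ∣J∣ ∣I∩J∣)
Adjacent-intro (inside ∷ I) (outside ∷ J) ∣I∣ ∣J∣ ∣I∩J∣
  with card-∩⇒≡-minus I J (suc-injective ∣I∣) ∣J∣ ∣I∩J∣
... | b , b∈J , refl =
  subst (Adjacent _) (∷-minus-zero inside J) (adjacent (inside ∷ J) here (there b∈J) λ ())
Adjacent-intro (outside ∷ I) (inside ∷ J) ∣I∣ ∣J∣ ∣I∩J∣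
  with card-∩⇒≡-minus J I (suc-injective ∣J∣) ∣I∣ (trans (cong ∣_∣ (∩-comm J I)) ∣I∩J∣)
... | a , a∈I , refl =
  subst (λ K → Adjacent K (inside ∷ (I - a))) (∷-minus-zero inside I) (adjacent (inside ∷ I) (there a∈I) here λ ())

x∈p⇒∣p-x∣+1≡∣p∣ : ∀ {m} {p : Subset m} {x} → x ∈ p → ∣ p - x ∣ + 1 ≡ ∣ p ∣
x∈p⇒∣p-x∣+1≡∣p∣ {p = inside ∷ p} here = trans (+-comm _ 1) (cong (suc ∘ ∣_∣) (p─⊥≡p p))
x∈p⇒∣p-x∣+1≡∣p∣ {p = outside ∷ p} (there x∈p) = x∈p⇒∣p-x∣+1≡∣p∣ x∈p
x∈p⇒∣p-x∣+1≡∣p∣ {p = inside ∷ p} (there x∈p) = cong suc (x∈p⇒∣p-x∣+1≡∣p∣ x∈p)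

Adjacent-rotate : ∀ {m r} (σ : SignMap (suc m)) → IsSignotope (suc m) r σ →
  ∀ {I J} → ∣ I ∣ + 1 ≡ r → Adjacent I J → Prec (suc m) r σ I J →
  ((zero ∉ I ∩ J) → Prec (suc m) r (rotSignMap σ) (rotSubset I) (rotSubset J)) ×
  ((zero ∈ I ∩ J) → Prec (suc m) r (rotSignMap σ) (rotSubset J) (rotSubset I))
Adjacent-rotate {r = r} σ sig ∣I∣ (adjacent X a∈X b∈X a≢b) I≺J =
  Product.map (Oriented⇒Prec-rot σ ∣X∣ a∈X b∈X ∘_) (Oriented⇒Prec-rot σ ∣X∣ b∈X a∈X ∘_)
    (Oriented-rotate (σ X) a∈X b∈X a≢b (Prec⇒Oriented sig ∣X∣ a∈X b∈X a≢b I≺J))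
  where
  ∣X∣ : ∣ X ∣ ≡ r
  ∣X∣ = trans (sym (x∈p⇒∣p-x∣+1≡∣p∣ b∈X)) ∣I∣

lemma13 : (m r : ℕ) (σ : SignMap (suc m)) → IsSignotope (suc m) r σ →
    (I J : Subset (suc m)) → ∣ I ∣ + 1 ≡ r → ∣ J ∣ + 1 ≡ r → ∣ I ∩ J ∣ + 2 ≡ r →
    Prec (suc m) r σ I J →
    ((zero ∉ I ∩ J) → Prec (suc m) r (rotSignMap σ) (rotSubset I) (rotSubset J)) ×
    ((zero ∈ I ∩ J) → Prec (suc m) r (rotSignMap σ) (rotSubset J) (rotSubset I))
lemma13 m r σ sig I J ∣I∣ ∣J∣ ∣I∩J∣ =
  Adjacent-rotate σ sig ∣I∣ (Adjacent-intro I J (one-more {I} ∣I∣) (one-more {J} ∣J∣) refl)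
  where
  one-more : ∀ {K : Subset (suc m)} → ∣ K ∣ + 1 ≡ r → ∣ K ∣ ≡ suc ∣ I ∩ J ∣
  one-more ∣K∣ = +-cancelʳ-≡ 1 _ _ (trans ∣K∣ (trans (sym ∣I∩J∣) (+-suc ∣ I ∩ J ∣ 1)))
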